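{- Let $G$ be a finite group and let $G'=[G,G]$ be its commutator subgroup. Then $$\mathsf D(G)\leq \mathsf d(G)+2|G'|-1,$$ with equality if and only if $G$ is abelian.
   Context: Let $G$ be a finite group written multiplicatively with identity $1$. A sequence over $G$ is a finite, unordered list of elements of $G$ with repetition allowed (a finite multiset); its length $|S|$ is its number of terms counted with multiplicity, and a subsequence is a sub-multiset. A sequence is product-one if its terms can be ordered so that their product equals $1$. A minimal product-one sequence (atom) is a nontrivial (nonempty) product-one sequence that cannot be partitioned into two nontrivial product-one subsequences. The small Davenport constant $\mathsf d(G)$ is the maximal integer $\ell$ such that there is a sequence over $G$ of length $\ell$ having no nontrivial product-one subsequence. The large Davenport constant $\mathsf D(G)$ is the maximal length of a minimal product-one sequence over $G$. -}

module Defs where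

open import Level using (Level; _⊔_)
open import Algebra.Bundles using (Group)
open import Data.Nat using (ℕ; _≤_)
open import Data.List using (List; []; _∷_; _++_; foldr; length)
open import Data.List.Relation.Unary.Any using (Any)
open import Data.List.Relation.Unary.All using (All)
open import Data.List.Relation.Binary.Permutation.Propositional using (_↭_)
open import Data.Product using (Σ; ∃; _×_; _,_)
open import Data.Sum using (_⊎_)
open import Relation.Nullary using (¬_)

module GroupNotions {c ℓ : Level} (G : Group c ℓ) where
  open Group G

  IsFinite : Set (c ⊔ ℓ)
  IsFinite = Σ (List Carrier) λ xs → ∀ x → Any (x ≈_) xs

  -- Sequences over G: finite lists, considered up to reordering (_↭_).
  Seq : Set c
  Seq = List Carrier

  prod : Seq → Carrier
  prod = foldr _∙_ ε

  ProductOne : Seq → Set (c ⊔ ℓ)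
  ProductOne S = Σ Seq λ S' → (S ↭ S') × (prod S' ≈ ε)

  NonEmpty : Seq → Set c
  NonEmpty S = ¬ (S ≡L [])
    where
    open import Relation.Binary.PropositionalEquality renaming (_≡_ to _≡L_)

  SubSeq : Seq → Seq → Set c
  SubSeq T S = Σ Seq λ U → S ↭ (T ++ U)

  ProductOneFree : Seq → Set (c ⊔ ℓ)
  ProductOneFree S = ∀ T → SubSeq T S → NonEmpty T → ¬ ProductOne T

  MinimalProductOne : Seq → Set (c ⊔ ℓ)
  MinimalProductOne S =
    NonEmpty S × ProductOne S ×
    (∀ T U → S ↭ (T ++ U) → NonEmpty T → NonEmpty U →
       ¬ (ProductOne T × ProductOne U))

  IsSmallDavenport : ℕ → Set (c ⊔ ℓ)
  IsSmallDavenport n =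
    (Σ Seq λ S → (length S ≡N n) × ProductOneFree S) ×
    (∀ S → ProductOneFree S → length S ≤ n)
    where
    open import Relation.Binary.PropositionalEquality renaming (_≡_ to _≡N_)

  IsLargeDavenport : ℕ → Set (c ⊔ ℓ)
  IsLargeDavenport n =
    (Σ Seq λ S → (length S ≡N n) × MinimalProductOne S) ×
    (∀ S → MinimalProductOne S → length S ≤ n)
    where
    open import Relation.Binary.PropositionalEquality renaming (_≡_ to _≡N_)

  IsCommutator : Carrier → Set (c ⊔ ℓ)
  IsCommutator z = Σ Carrier λ x → Σ Carrier λ y → z ≈ ((x ⁻¹ ∙ y ⁻¹) ∙ x) ∙ y

  InCommutatorSubgroup : Carrier → Set (c ⊔ ℓ)
  InCommutatorSubgroup z =
    Σ (List Carrier) λ gs →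
      All (λ g → IsCommutator g ⊎ IsCommutator (g ⁻¹)) gs × (z ≈ prod gs)

  -- The subset P of G (respecting ≈) has exactly n elements:
  -- a duplicate-free (w.r.t. ≈) list of length n listing exactly P.
  HasCard : (Carrier → Set (c ⊔ ℓ)) → ℕ → Set (c ⊔ ℓ)
  HasCard P n =
    Σ (List Carrier) λ xs →
      (length xs ≡N n) × AllPairs (λ x y → ¬ (x ≈ y)) xs × All P xs ×
      (∀ x → P x → Any (x ≈_) xs)
    where
    open import Relation.Binary.PropositionalEquality renaming (_≡_ to _≡N_)
    open import Data.List.Relation.Unary.AllPairs using (AllPairs)

  IsAbelian : Set (c ⊔ ℓ)
  IsAbelian = ∀ x y → (x ∙ y) ≈ (y ∙ x)

{-# OPTIONS --safe #-}
-- Order an atom S of length D so that its product is 1, and split it as T · U, keeping a set X of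
-- products of orderings of T such that |T| ≤ 2|X| - 2 and 1 ∈ X u, where u is the product of U in
-- its current order; at the start T = ∅ and X = {1}.  Suppose y ∈ X satisfies y u = 1.
--  * If U begins with g, say u = g v, either y g ∈ g X, and then 1 ∈ X v g, i.e. U may be rotated,
--    or g joins T and X is replaced by the larger set g X ∪ {y g}.
--  * If U begins with g, h, either y g h ∈ X h g, and then g and h may be swapped in U, or both
--    join T and X is replaced by the larger set X h g ∪ {y g h}.
-- When X can no longer grow, 1 ∈ X u' for every reordering u' of U, because rotations and swaps
-- at the front generate all reorderings.  A product-one subsequence V of U can then be moved to the
-- right end and split off from S, so U (if T = ∅: U without one term) is product-one free.
-- As X u lies in G', |X| ≤ |G'|, so |S| ≤ d + 2|G'| - 2 or |S| ≤ d + 1.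
-- Conversely, appending the inverse of its product to a product-one free sequence gives an atom,
-- so D ≥ d + 1, and |G'| = 1 exactly when G is abelian.
module Submission where

open import Defs
open import Level using (Level; _⊔_)
open import Algebra.Bundles using (Group)
open import Data.Nat using (ℕ; zero; suc; _≤_; _<_; _+_; _*_; _∸_; z≤n; s≤s; _≤?_)
open import Data.Nat.Properties
open import Data.List using (List; []; _∷_; [_]; _++_; length; map; _∷ʳ_)
import Data.List.Properties as List
open import Data.List.Membership.Propositional using (_∈_)
open import Data.List.Membership.Propositional.Properties using (∈-∃++; ∈-++⁻)
open import Data.List.Relation.Binary.Permutation.Propositional
  using (_↭_; prep; swap; ↭-refl; ↭-reflexive; ↭-sym; ↭-trans)
  renaming (refl to ↭refl; trans to ↭trans)
open import Data.List.Relation.Binary.Permutation.Propositional.Properties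
  using (∈-resp-↭; ↭-length; ++⁺ˡ; ++⁺ʳ; shift; ∷↭∷ʳ; ++-comm; drop-∷)
open import Data.List.Relation.Unary.All as All using (All; []; _∷_)
import Data.List.Relation.Unary.All.Properties as All
open import Data.List.Relation.Unary.AllPairs as AllPairs using (AllPairs; []; _∷_)
import Data.List.Relation.Unary.AllPairs.Properties as AllPairs
open import Data.List.Relation.Unary.Any as Any using (Any; here; there; _─_; index)
open import Data.Product using (Σ; ∃; _×_; _,_; proj₁; proj₂)
open import Data.Sum using (_⊎_; inj₁; inj₂)
open import Function.Base using (_∘_)
open import Function.Bundles using (_⇔_; mk⇔)
open import Relation.Binary.PropositionalEquality as ≡ using (_≡_)
open import Relation.Nullary using (¬_; contradiction)
open import Relation.Nullary.Decidable using (decidable-stable; _⊎-dec_)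

module _ {c ℓ : Level} (G : Group c ℓ) where
  open Group G
  open GroupNotions G
  open import Algebra.Properties.Group G
  open import Relation.Binary.Reasoning.Setoid setoid

  -- Counting up to `_≈_`

  Distinct : List Carrier → Set (c ⊔ ℓ)
  Distinct = AllPairs (λ x y → ¬ (x ≈ y))

  ∈-─ : ∀ {x y xs} → Any (x ≈_) xs → (y∈xs : Any (y ≈_) xs) → ¬ (y ≈ x) → Any (x ≈_) (xs ─ y∈xs)
  ∈-─ (here x≈z)   (here y≈z)   y≉x = contradiction (trans y≈z (sym x≈z)) y≉x
  ∈-─ (here x≈z)   (there y∈xs) y≉x = here x≈z
  ∈-─ (there x∈xs) (here y≈z)   y≉x = x∈xs
  ∈-─ (there x∈xs) (there y∈xs) y≉x = there (∈-─ x∈xs y∈xs y≉x)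

  -- Pigeonhole by induction: the match of the head is deleted from `ys`, and distinctness keeps the
  -- matches of the tail.
  distinct-length-≤ : ∀ {xs ys} → Distinct xs → All (λ x → Any (x ≈_) ys) xs → length xs ≤ length ys
  distinct-length-≤ [] [] = z≤n
  distinct-length-≤ {ys = ys} (x≉xs ∷ xs!) (x∈ys ∷ xs⊆ys) =
    ≡.subst (_ ≤_) (≡.sym (List.length-removeAt′ ys (index x∈ys)))
      (s≤s (distinct-length-≤ xs! (All.zipWith (λ (y∈ys , x≉y) → ∈-─ y∈ys x∈ys x≉y) (xs⊆ys , x≉xs))))

  -- Reordered products and commutators

  prod-++ : ∀ xs ys → prod (xs ++ ys) ≈ prod xs ∙ prod ys
  prod-++ []       ys = sym (identityˡ _)
  prod-++ (x ∷ xs) ys = trans (∙-congˡ (prod-++ xs ys)) (sym (assoc _ _ _))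

  xy≈ε⇒yx≈ε : ∀ {x y} → x ∙ y ≈ ε → y ∙ x ≈ ε
  xy≈ε⇒yx≈ε {x} {y} xy≈ε = trans (∙-congʳ (inverseʳ-unique x y xy≈ε)) (inverseˡ x)

  ⟨_,_⟩ : Carrier → Carrier → Carrier
  ⟨ x , y ⟩ = ((x ⁻¹ ∙ y ⁻¹) ∙ x) ∙ y

  swap-∙ : ∀ x y → x ∙ y ≈ (y ∙ x) ∙ ⟨ x , y ⟩
  swap-∙ x y = sym (begin
    (y ∙ x) ∙ (((x ⁻¹ ∙ y ⁻¹) ∙ x) ∙ y)  ≈⟨ ∙-congˡ (assoc _ _ _) ⟩
    (y ∙ x) ∙ ((x ⁻¹ ∙ y ⁻¹) ∙ (x ∙ y))  ≈⟨ ∙-congˡ (∙-congʳ (⁻¹-anti-homo-∙ y x)) ⟨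
    (y ∙ x) ∙ ((y ∙ x) ⁻¹ ∙ (x ∙ y))     ≈⟨ assoc _ _ _ ⟨
    ((y ∙ x) ∙ (y ∙ x) ⁻¹) ∙ (x ∙ y)     ≈⟨ ∙-congʳ (inverseʳ _) ⟩
    ε ∙ (x ∙ y)                          ≈⟨ identityˡ _ ⟩
    x ∙ y                                ∎)

  CommutatorProduct : List Carrier → Set (c ⊔ ℓ)
  CommutatorProduct = All (λ g → IsCommutator g ⊎ IsCommutator (g ⁻¹))

  prod-↭ : ∀ {xs ys} → xs ↭ ys → ∃ λ gs → CommutatorProduct gs × prod ys ≈ prod xs ∙ prod gs
  prod-↭ ↭refl = [] , [] , sym (identityʳ _)
  prod-↭ (prep x xs↭ys) with gs , comms , eq ← prod-↭ xs↭ys =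
    gs , comms , trans (∙-congˡ eq) (sym (assoc _ _ _))
  prod-↭ (swap {xs} {ys} x y xs↭ys) with gs , comms , eq ← prod-↭ xs↭ys =
    -- `k` arises from exchanging `x` and `y`; carrying it to the right past `a` costs the further
    -- commutator `⟨ k , a ⟩`.
    k ∷ ⟨ k , a ⟩ ∷ gs
    , inj₁ (y , x , refl) ∷ inj₁ (k , a , refl) ∷ comms
    , (begin
      y ∙ (x ∙ prod ys)                      ≈⟨ assoc _ _ _ ⟨
      (y ∙ x) ∙ prod ys                      ≈⟨ ∙-cong (swap-∙ y x) eq ⟩
      ((x ∙ y) ∙ k) ∙ (a ∙ p)                ≈⟨ assoc _ _ _ ⟩
      (x ∙ y) ∙ (k ∙ (a ∙ p))                ≈⟨ ∙-congˡ (assoc _ _ _) ⟨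
      (x ∙ y) ∙ ((k ∙ a) ∙ p)                ≈⟨ ∙-congˡ (∙-congʳ (swap-∙ k a)) ⟩
      (x ∙ y) ∙ (((a ∙ k) ∙ ⟨ k , a ⟩) ∙ p)  ≈⟨ ∙-congˡ (assoc _ _ _) ⟩
      (x ∙ y) ∙ ((a ∙ k) ∙ (⟨ k , a ⟩ ∙ p))  ≈⟨ ∙-congˡ (assoc _ _ _) ⟩
      (x ∙ y) ∙ (a ∙ (k ∙ (⟨ k , a ⟩ ∙ p)))  ≈⟨ assoc _ _ _ ⟨
      ((x ∙ y) ∙ a) ∙ (k ∙ (⟨ k , a ⟩ ∙ p))  ≈⟨ ∙-congʳ (assoc _ _ _) ⟩
      (x ∙ (y ∙ a)) ∙ (k ∙ (⟨ k , a ⟩ ∙ p))  ∎)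
    where k = ⟨ y , x ⟩ ; a = prod xs ; p = prod gs
  prod-↭ (↭trans {xs} {ys} {zs} xs↭ys ys↭zs)
    with gs , comms , eq ← prod-↭ xs↭ys | hs , comms′ , eq′ ← prod-↭ ys↭zs =
    gs ++ hs , All.++⁺ comms comms′ , (begin
      prod zs                        ≈⟨ eq′ ⟩
      prod ys ∙ prod hs              ≈⟨ ∙-congʳ eq ⟩
      (prod xs ∙ prod gs) ∙ prod hs  ≈⟨ assoc _ _ _ ⟩
      prod xs ∙ (prod gs ∙ prod hs)  ≈⟨ ∙-congˡ (prod-++ gs hs) ⟨
      prod xs ∙ prod (gs ++ hs)      ∎)

  ε∈G′ : InCommutatorSubgroup ε
  ε∈G′ = [] , [] , refl

  -- Products over all orderings

  infix 4 _∈π_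
  -- `ProductOne S` unfolds to `ε ∈π S`, so the closure lemmas below also produce product-one
  -- sequences.
  _∈π_ : Carrier → Seq → Set (c ⊔ ℓ)
  x ∈π S = ∃ λ S′ → S ↭ S′ × prod S′ ≈ x

  ∈π-∷ : ∀ {T y} x → y ∈π T → x ∙ y ∈π x ∷ T
  ∈π-∷ x (T′ , T↭T′ , eq) = x ∷ T′ , prep x T↭T′ , ∙-congˡ eq

  ∈π-++ : ∀ {T y} U → y ∈π T → y ∙ prod U ∈π T ++ U
  ∈π-++ U (T′ , T↭T′ , eq) = T′ ++ U , ++⁺ʳ U T↭T′ , trans (prod-++ T′ U) (∙-congʳ eq)

  ∈π-resp-↭ : ∀ {S T x} → S ↭ T → x ∈π S → x ∈π T
  ∈π-resp-↭ S↭T (S′ , S↭S′ , eq) = S′ , ↭-trans (↭-sym S↭T) S↭S′ , eq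

  ∈π-resp-≈ : ∀ {S x y} → x ≈ y → x ∈π S → y ∈π S
  ∈π-resp-≈ x≈y (S′ , S↭S′ , eq) = S′ , S↭S′ , trans eq x≈y

  -- All orderings have products in one coset of G', and one of these products is 1.
  π⊆G′ : ∀ {S x} → ProductOne S → x ∈π S → InCommutatorSubgroup x
  π⊆G′ (S₁ , S↭S₁ , prod≈ε) (S₂ , S↭S₂ , prod≈x)
    with gs , comms , eq ← prod-↭ (↭-trans (↭-sym S↭S₁) S↭S₂) =
    gs , comms , (begin
      _                  ≈⟨ prod≈x ⟨
      prod S₂            ≈⟨ eq ⟩
      prod S₁ ∙ prod gs  ≈⟨ ∙-congʳ prod≈ε ⟩
      ε ∙ prod gs        ≈⟨ identityˡ _ ⟩
      prod gs            ∎)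

  adjoin : ∀ {z} {f : Carrier → Carrier} {X} → (∀ {x y} → f x ≈ f y → x ≈ y) →
           Distinct X → ¬ Any (λ x → z ≈ f x) X → Distinct (z ∷ map f X)
  adjoin f-inj X! z∉fX =
    All.map⁺ (All.¬Any⇒All¬ _ z∉fX) ∷ AllPairs.map⁺ (AllPairs.map (_∘ f-inj) X!)

  -- Growing the set of products

  module _ {S : Seq} where

    -- `large` is |T| ≤ 2|X| - 2 without subtraction: each new element of `X` pays for at most two
    -- terms joining `T`.
    record Splitting (T : Seq) (X : List Carrier) : Set (c ⊔ ℓ) where
      field
        distinct : Distinct X
        products : All (_∈π T) X
        large    : 2 + length T ≤ 2 * length X

    Hits : Seq → List Carrier → Seq → Set (c ⊔ ℓ)
    Hits T X U = T ++ U ↭ S × Any (λ y → y ∙ prod U ≈ ε) X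

    -- Growth is measured by the length of `T`, which cannot exceed that of `S`.
    Extension : Seq → Set (c ⊔ ℓ)
    Extension T = Σ Seq λ T′ → Σ (List Carrier) λ X′ → Σ Seq λ U′ →
      length T < length T′ × Splitting T′ X′ × Hits T′ X′ U′

    large-step : ∀ {m n} → 2 + m ≤ 2 * n → 4 + m ≤ 2 * suc n
    large-step {m} {n} 2+m≤2n = ≡.subst (4 + m ≤_) (≡.sym (*-suc 2 n)) (+-monoʳ-≤ 2 2+m≤2n)

    module _ {T X} (split : Splitting T X) (maximal : ¬ Extension T) where
      open Splitting split

      rotate₁ : ∀ {x U} → Hits T X (x ∷ U) → ¬ ¬ Hits T X (U ∷ʳ x)
      rotate₁ {x} {U} (TxU↭S , hit) ¬hits =
        maximal (x ∷ T , y ∙ x ∷ map (x ∙_) X , U , ≤-refl , split′ ,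
                 ↭-trans (↭-sym (shift x T U)) TxU↭S , here (trans (assoc _ _ _) y∙xu≈ε))
        where
        y = Any.lookup hit
        y∈πT = proj₁ (All.lookupAny products hit)
        y∙xu≈ε = proj₂ (All.lookupAny products hit)

        y∙x∉xX : ¬ Any (λ z → y ∙ x ≈ x ∙ z) X
        y∙x∉xX y∙x∈xX = ¬hits
          ( ↭-trans (++⁺ˡ T (↭-sym (∷↭∷ʳ x U))) TxU↭S
          -- The equation turns `y ∙ (x ∙ prod U) ≈ ε` into `x ∙ (z ∙ prod U) ≈ ε`; moving `x`
          -- cyclically to the end shows that `z` hits the rotated sequence.
          , Any.map (λ {z} yx≈xz → begin
              z ∙ prod (U ∷ʳ x)    ≈⟨ ∙-congˡ (trans (prod-++ U [ x ]) (∙-congˡ (identityʳ x))) ⟩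
              z ∙ (prod U ∙ x)     ≈⟨ assoc _ _ _ ⟨
              (z ∙ prod U) ∙ x     ≈⟨ xy≈ε⇒yx≈ε (begin
                x ∙ (z ∙ prod U)   ≈⟨ assoc _ _ _ ⟨
                (x ∙ z) ∙ prod U   ≈⟨ ∙-congʳ yx≈xz ⟨
                (y ∙ x) ∙ prod U   ≈⟨ assoc _ _ _ ⟩
                y ∙ (x ∙ prod U)   ≈⟨ y∙xu≈ε ⟩
                ε                  ∎) ⟩
              ε                    ∎) y∙x∈xX )

        split′ : Splitting (x ∷ T) (y ∙ x ∷ map (x ∙_) X)
        split′ = record
          { distinct = adjoin (∙-cancelˡ x _ _) distinct y∙x∉xX
          ; products = ∈π-resp-↭ (↭-sym (∷↭∷ʳ x T)) (∈π-resp-≈ (∙-congˡ (identityʳ x)) (∈π-++ [ x ] y∈πT))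
                       ∷ All.map⁺ (All.map (∈π-∷ x) products)
          ; large = ≡.subst (λ n → 3 + length T ≤ 2 * suc n) (≡.sym (List.length-map _ X))
                      -- Only one term joins `T`, so the estimate for two terms has one to spare.
                      (≤-trans (n≤1+n _) (large-step large))
          }

      swap₁ : ∀ {x y U} → Hits T X (x ∷ y ∷ U) → ¬ ¬ Hits T X (y ∷ x ∷ U)
      swap₁ {x} {y} {U} (TxyU↭S , hit) ¬hits =
        maximal (T′ , z ∙ xy ∷ map (_∙ yx) X , U , m<n⇒m<1+n ≤-refl , split′ ,
                 ↭-trans (↭-sym (↭-trans (shift x T (y ∷ U)) (prep x (shift y T U)))) TxyU↭S ,
                 here (trans (assoc _ _ _) (trans (∙-congˡ (sym (xy∙ (prod U)))) z∙xyu≈ε)))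
        where
        z = Any.lookup hit
        z∈πT = proj₁ (All.lookupAny products hit)
        z∙xyu≈ε = proj₂ (All.lookupAny products hit)
        T′ = x ∷ y ∷ T
        -- Both products keep the trailing `ε` of `prod`, to match `∈π-++`.
        xy = prod (x ∷ y ∷ [])
        yx = prod (y ∷ x ∷ [])

        xy∙ : ∀ u → x ∙ (y ∙ u) ≈ xy ∙ u
        xy∙ u = trans (sym (assoc _ _ _)) (∙-congʳ (∙-congˡ (sym (identityʳ y))))

        z∙xy∉Xyx : ¬ Any (λ w → z ∙ xy ≈ w ∙ yx) X
        z∙xy∉Xyx z∙xy∈Xyx = ¬hits
          ( ↭-trans (++⁺ˡ T (swap y x ↭-refl)) TxyU↭S
          , Any.map (λ {w} zxy≈wyx → begin
              w ∙ prod (y ∷ x ∷ U)    ≈⟨ ∙-congˡ (prod-++ (y ∷ x ∷ []) U) ⟩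
              w ∙ (yx ∙ prod U)       ≈⟨ assoc _ _ _ ⟨
              (w ∙ yx) ∙ prod U       ≈⟨ ∙-congʳ zxy≈wyx ⟨
              (z ∙ xy) ∙ prod U       ≈⟨ assoc _ _ _ ⟩
              z ∙ (xy ∙ prod U)       ≈⟨ ∙-congˡ (xy∙ (prod U)) ⟨
              z ∙ prod (x ∷ y ∷ U)    ≈⟨ z∙xyu≈ε ⟩
              ε                       ∎) z∙xy∈Xyx )

        split′ : Splitting T′ (z ∙ xy ∷ map (_∙ yx) X)
        split′ = record
          { distinct = adjoin (∙-cancelʳ yx _ _) distinct z∙xy∉Xyx
          ; products = ∈π-resp-↭ (++-comm T (x ∷ y ∷ [])) (∈π-++ (x ∷ y ∷ []) z∈πT)
                       ∷ All.map⁺ (All.map (∈π-resp-↭ (↭-trans (++-comm T (y ∷ x ∷ [])) (swap y x ↭-refl))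
                                             ∘ ∈π-++ (y ∷ x ∷ [])) products)
          ; large = ≡.subst (λ n → 4 + length T ≤ 2 * suc n) (≡.sym (List.length-map _ X))
                      (large-step large)
          }

      -- From rotations and swaps to all reorderings

      rotate : ∀ A B → Hits T X (A ++ B) → ¬ ¬ Hits T X (B ++ A)
      rotate []      B hits ¬hits = ¬hits (≡.subst (Hits T X) (≡.sym (List.++-identityʳ B)) hits)
      rotate (a ∷ A) B hits ¬hits = rotate₁ hits λ hits₁ →
        rotate A (B ∷ʳ a) (≡.subst (Hits T X) (List.++-assoc A B [ a ]) hits₁) λ hits₂ →
        ¬hits (≡.subst (Hits T X) (List.∷ʳ-++ B a A) hits₂)

      -- The arbitrary context `C` makes the induction work: terms in front can be parked behind it.
      Permutes : Seq → Seq → Set (c ⊔ ℓ)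
      Permutes U U′ = ∀ C → Hits T X (U ++ C) → ¬ ¬ Hits T X (U′ ++ C)

      -- `x` is rotated to the far end, the rest is permuted in front of the longer context, and `x`
      -- is rotated back.
      permutes-∷ : ∀ x {U U′} → Permutes U U′ → Permutes (x ∷ U) (x ∷ U′)
      permutes-∷ x {U} {U′} perm C hits ¬hits = rotate₁ hits λ hits₁ →
        perm (C ∷ʳ x) (≡.subst (Hits T X) (List.++-assoc U C [ x ]) hits₁) λ hits₂ →
        rotate (U′ ++ C) [ x ] (≡.subst (Hits T X) (≡.sym (List.++-assoc U′ C [ x ])) hits₂) ¬hits

      permutes : ∀ {U U′} → U ↭ U′ → Permutes U U′
      permutes ↭refl C hits ¬hits = ¬hits hits
      permutes (prep x U↭U′) = permutes-∷ x (permutes U↭U′)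
      permutes (swap x y U↭U′) C hits ¬hits = swap₁ hits λ hits₁ →
        permutes-∷ y (permutes-∷ x (permutes U↭U′)) C hits₁ ¬hits
      permutes (↭trans U↭U′ U′↭U″) C hits ¬hits =
        permutes U↭U′ C hits λ hits₁ → permutes U′↭U″ C hits₁ ¬hits

      hits-↭ : ∀ {U U′} → U ↭ U′ → Hits T X U → ¬ ¬ Hits T X U′
      hits-↭ {U} {U′} U↭U′ hits ¬hits =
        permutes U↭U′ [] (≡.subst (Hits T X) (≡.sym (List.++-identityʳ U)) hits) λ hits₁ →
        ¬hits (≡.subst (Hits T X) (List.++-identityʳ U′) hits₁)

      no-product-one : MinimalProductOne S → ∀ {U} → Hits T X U → ∀ V W → U ↭ V ++ W →
                       NonEmpty (T ++ V) → NonEmpty W → ¬ ProductOne W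
      no-product-one (_ , _ , irreducible) {U} hits V W U↭VW TV≢[] W≢[] W-one@(W′ , W↭W′ , w≈ε) =
        hits-↭ (↭-trans U↭VW (++⁺ˡ V W↭W′)) hits λ (TVW′↭S , hit) →
        let y∈πT , yvw≈ε = All.lookupAny products hit
            y = Any.lookup hit
            yv≈ε = begin
              y ∙ prod V              ≈⟨ identityʳ _ ⟨
              (y ∙ prod V) ∙ ε        ≈⟨ ∙-congˡ w≈ε ⟨
              (y ∙ prod V) ∙ prod W′  ≈⟨ assoc _ _ _ ⟩
              y ∙ (prod V ∙ prod W′)  ≈⟨ ∙-congˡ (prod-++ V W′) ⟨
              y ∙ prod (V ++ W′)      ≈⟨ yvw≈ε ⟩
              ε                       ∎
            S↭TVW = ↭-trans (↭-sym TVW′↭S) (↭-trans (++⁺ˡ T (++⁺ˡ V (↭-sym W↭W′)))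
                      (↭-reflexive (≡.sym (List.++-assoc T V W))))
        in irreducible (T ++ V) W S↭TVW TV≢[] W≢[] (∈π-resp-≈ yv≈ε (∈π-++ V y∈πT) , W-one)

    -- Bounding the length of an atom

    hits-length : ∀ T {X U} → Hits T X U → length S ≡ length T + length U
    hits-length T (TU↭S , _) = ≡.trans (↭-length (↭-sym TU↭S)) (List.length-++ T)

    -- Elements of `X` need not lie in G', but their right translates by `prod U` are products of
    -- orderings of `S` and do.
    splitting-bound : ∀ {T X U k} → ProductOne S → HasCard InCommutatorSubgroup k →
                      Splitting T X → Hits T X U → length X ≤ k
    splitting-bound {X = X} {U} S-one (xs , length≡k , _ , _ , complete) split (TU↭S , _) =
      ≡.subst₂ _≤_ (List.length-map (_∙ prod U) X) length≡k
        (distinct-length-≤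
          (AllPairs.map⁺ (AllPairs.map (λ y≉z → y≉z ∘ ∙-cancelʳ (prod U) _ _) distinct))
          (All.map⁺ (All.map (complete _ ∘ π⊆G′ S-one ∘ ∈π-resp-↭ TU↭S ∘ ∈π-++ U) products)))
      where open Splitting split

    maximal-bound : ∀ T {X U d k} → MinimalProductOne S → (∀ R → ProductOneFree R → length R ≤ d) →
                    length X ≤ k → Splitting T X → ¬ Extension T → Hits T X U →
                    2 + length S ≤ d + 2 * k ⊎ length S ≤ suc d
    maximal-bound [] {U = []} atom free≤d X≤k split maximal hits =
      inj₂ (≤-trans (≤-reflexive (hits-length [] hits)) z≤n)
    -- With `T` empty, `u` is set aside so that the complement of `W` in `S` stays nonempty.
    maximal-bound [] {U = u ∷ U} atom free≤d X≤k split maximal hits =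
      inj₂ (≤-trans (≤-reflexive (hits-length [] hits)) (s≤s (free≤d U λ W (V , U↭WV) W≢[] →
        no-product-one split maximal atom hits (u ∷ V) W (prep u (↭-trans U↭WV (++-comm W V)))
          (λ ()) W≢[])))
    -- Here `T` itself keeps the complement nonempty, so all of `U` is product-one free.
    maximal-bound T@(_ ∷ _) {X} {U} {d} {k} atom free≤d X≤k split maximal hits =
      inj₁ (≤-trans (≤-reflexive (≡.cong (2 +_) (hits-length T hits)))
        (≤-trans (+-mono-≤ (Splitting.large split) U≤d)
          (≤-trans (+-monoˡ-≤ d (*-monoʳ-≤ 2 X≤k)) (≤-reflexive (+-comm (2 * k) d)))))
      where
      U≤d : length U ≤ d
      U≤d = free≤d U λ W (V , U↭WV) →
        no-product-one split maximal atom hits V W (↭-trans U↭WV (++-comm W V)) (λ ())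

    -- _≈_ is not decidable, so whether X can grow is only decided up to double negation.
    search : ∀ {d k} → MinimalProductOne S → (∀ R → ProductOneFree R → length R ≤ d) →
             HasCard InCommutatorSubgroup k →
             ∀ n {T X U} → length S < n + length T → Splitting T X → Hits T X U →
             ¬ ¬ (2 + length S ≤ d + 2 * k ⊎ length S ≤ suc d)
    search atom free≤d card zero {T} S<T split hits _ =
      <-irrefl (hits-length T hits) (<-≤-trans S<T (m≤m+n (length T) _))
    search atom free≤d card (suc n) {T} S<1+n+T split hits ¬bound =
      ¬bound (maximal-bound T atom free≤d (splitting-bound (proj₁ (proj₂ atom)) card split hits)
        split maximal hits)
      where
      maximal : ¬ Extension T
      -- An extension would yield the bound with less fuel, against `¬bound`.
      maximal (T′ , X′ , U′ , T<T′ , split′ , hits′) =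
        search atom free≤d card n (<-≤-trans S<1+n+T
          (≤-trans (≤-reflexive (≡.sym (+-suc n (length T)))) (+-monoʳ-≤ n T<T′))) split′ hits′ ¬bound

  atom-bound : ∀ {S d k} → MinimalProductOne S → (∀ R → ProductOneFree R → length R ≤ d) →
               HasCard InCommutatorSubgroup k → 2 + length S ≤ d + 2 * k ⊎ length S ≤ suc d
  atom-bound {S} atom@(_ , (S′ , S↭S′ , prod≈ε) , _) free≤d card =
    -- Inequalities of naturals are decidable, so the double negation can be removed.
    decidable-stable ((_ ≤? _) ⊎-dec (_ ≤? _))
      (search atom free≤d card (suc (length S)) (m≤m+n _ 0) initial
        (↭-sym S↭S′ , here (trans (identityˡ _) prod≈ε)))
    where
    initial : Splitting [] [ ε ]
    initial = record
      { distinct = [] ∷ []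
      ; products = ([] , ↭-refl , refl) ∷ []
      ; large    = ≤-refl
      }

  -- Atoms from product-one free sequences

  subSeq-of-tail : ∀ {g S T U} → g ∷ S ↭ T ++ U → g ∈ T → SubSeq U S
  subSeq-of-tail {g} {S} {T} {U} gS↭TU g∈T with A , B , ≡.refl ← ∈-∃++ g∈T =
    A ++ B , ↭-trans (drop-∷ (↭-trans gS↭TU (++⁺ʳ U (shift g A B)))) (++-comm (A ++ B) U)

  -- The added term lies in one of the two parts; the other part is then a product-one subsequence
  -- of `S`.
  free⇒atom : ∀ {S} → ProductOneFree S → MinimalProductOne (prod S ⁻¹ ∷ S)
  free⇒atom {S} free = (λ ()) , (_ , ↭-refl , inverseˡ _) , irreducible
    where
    irreducible : ∀ T U → prod S ⁻¹ ∷ S ↭ T ++ U → NonEmpty T → NonEmpty U →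
                  ¬ (ProductOne T × ProductOne U)
    irreducible T U gS↭TU T≢[] U≢[] (T-one , U-one)
      with ∈-++⁻ T (∈-resp-↭ gS↭TU (here ≡.refl))
    ... | inj₁ g∈T = free U (subSeq-of-tail gS↭TU g∈T) U≢[] U-one
    ... | inj₂ g∈U = free T (subSeq-of-tail (↭-trans gS↭TU (++-comm T U)) g∈U) T≢[] T-one

  -- Order of the commutator subgroup

  G′-nonempty : ∀ {k} → HasCard InCommutatorSubgroup k → 1 ≤ k
  G′-nonempty (xs , length≡k , _ , _ , complete) =
    ≡.subst (1 ≤_) length≡k (distinct-length-≤ ([] ∷ []) (complete ε ε∈G′ ∷ []))

  trivial-G′⇒abelian : ∀ {k} → HasCard InCommutatorSubgroup k → k ≤ 1 → IsAbelian
  trivial-G′⇒abelian (xs , ≡.refl , _ , _ , complete) k≤1 x y = begin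
    x ∙ y                ≈⟨ swap-∙ x y ⟩
    (y ∙ x) ∙ ⟨ x , y ⟩  ≈⟨ ∙-congˡ (collapse k≤1 (complete _ ⟨x,y⟩∈G′) (complete ε ε∈G′)) ⟩
    (y ∙ x) ∙ ε          ≈⟨ identityʳ _ ⟩
    y ∙ x                ∎
    where
    ⟨x,y⟩∈G′ : InCommutatorSubgroup ⟨ x , y ⟩
    ⟨x,y⟩∈G′ = [ ⟨ x , y ⟩ ] , inj₁ (x , y , refl) ∷ [] , sym (identityʳ _)

    collapse : ∀ {a b zs} → length zs ≤ 1 → Any (a ≈_) zs → Any (b ≈_) zs → a ≈ b
    collapse {zs = _ ∷ []}    _        (here a≈z) (here b≈z) = trans a≈z (sym b≈z)
    collapse {zs = _ ∷ _ ∷ _} (s≤s ())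

  abelian⇒trivial-G′ : ∀ {k} → HasCard InCommutatorSubgroup k → IsAbelian → k ≤ 1
  abelian⇒trivial-G′ (xs , ≡.refl , xs! , xs⊆G′ , _) comm =
    distinct-length-≤ {ys = [ ε ]} xs! (All.map (λ x∈G′ → here (G′-trivial x∈G′)) xs⊆G′)
    where
    commutator≈ε : ∀ {z} → IsCommutator z → z ≈ ε
    commutator≈ε (x , y , z≈⟨x,y⟩) =
      trans z≈⟨x,y⟩ (identityʳ-unique (y ∙ x) _ (trans (sym (swap-∙ x y)) (comm x y)))

    prod≈ε : ∀ {gs} → CommutatorProduct gs → prod gs ≈ ε
    prod≈ε [] = refl
    prod≈ε (inj₁ g ∷ gs) = trans (∙-cong (commutator≈ε g) (prod≈ε gs)) (identityˡ ε)
    prod≈ε (inj₂ g⁻¹ ∷ gs) =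
      trans (∙-cong (⁻¹-injective (trans (commutator≈ε g⁻¹) (sym ε⁻¹≈ε))) (prod≈ε gs)) (identityˡ ε)

    G′-trivial : ∀ {x} → InCommutatorSubgroup x → x ≈ ε
    G′-trivial (_ , comms , x≈prod) = trans x≈prod (prod≈ε comms)

theorem3p1 : ∀ {c ℓ : Level} (G : Group c ℓ) → GroupNotions.IsFinite G →
    (d D k : ℕ) → GroupNotions.IsSmallDavenport G d →
    GroupNotions.IsLargeDavenport G D →
    GroupNotions.HasCard G (GroupNotions.InCommutatorSubgroup G) k →
    (D ≤ d + 2 * k ∸ 1) × ((D ≡ d + 2 * k ∸ 1) ⇔ GroupNotions.IsAbelian G)
theorem3p1 G _ d D k ((R , ≡.refl , R-free) , free≤d) ((S , ≡.refl , atom) , atom≤D) card =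
  D≤ , mk⇔ equality⇒abelian abelian⇒equality
  where
  bound : 2 + D ≤ d + 2 * k ⊎ D ≤ suc d
  bound = atom-bound G atom free≤d card

  1≤k : 1 ≤ k
  1≤k = G′-nonempty G card

  1+D≤d+2k : 1 + D ≤ d + 2 * k
  1+D≤d+2k with bound
  ... | inj₁ 2+D≤d+2k = ≤-trans (n≤1+n _) 2+D≤d+2k
  ... | inj₂ D≤1+d    = ≤-trans (s≤s D≤1+d)
    (≤-trans (≤-reflexive (+-comm 2 d)) (+-monoʳ-≤ d (*-monoʳ-≤ 2 1≤k)))

  D≤ : D ≤ d + 2 * k ∸ 1
  D≤ = ∸-monoˡ-≤ 1 1+D≤d+2k

  equality⇒abelian : D ≡ d + 2 * k ∸ 1 → GroupNotions.IsAbelian G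
  equality⇒abelian D≡ = trivial-G′⇒abelian G card k≤1
    where
    d+2k≡1+D : d + 2 * k ≡ 1 + D
    -- The truncated subtraction is exact because d + 2k is positive.
    d+2k≡1+D = ≡.trans (≡.sym (m+[n∸m]≡n (≤-trans (s≤s z≤n) 1+D≤d+2k))) (≡.cong suc (≡.sym D≡))

    k≤1 : k ≤ 1
    k≤1 with bound
    -- The bound of the case of nonempty `T` is strict, so equality leaves only D ≤ d + 1, whence 2k
    -- ≤ 2.
    ... | inj₁ 2+D≤d+2k = contradiction (≤-trans 2+D≤d+2k (≤-reflexive d+2k≡1+D)) 1+n≰n
    ... | inj₂ D≤1+d    = *-cancelˡ-≤ 2 (+-cancelˡ-≤ d _ _
      (≤-trans (≤-reflexive d+2k≡1+D) (≤-trans (s≤s D≤1+d) (≤-reflexive (+-comm 2 d)))))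

  abelian⇒equality : GroupNotions.IsAbelian G → D ≡ d + 2 * k ∸ 1
  abelian⇒equality comm = ≤-antisym D≤
    -- With k ≤ 1 the right side is at most d + 1, the length of the atom built from `R`.
    (≤-trans (∸-monoˡ-≤ 1 (+-monoʳ-≤ d (*-monoʳ-≤ 2 (abelian⇒trivial-G′ G card comm))))
      (≤-trans (≤-reflexive (≡.cong (_∸ 1) (+-comm d 2))) (atom≤D _ (free⇒atom G R-free))))
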